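{- Let $n$ be a positive integer, let $\mathcal{Y}\subset Fl(\mathbb{C}^n)$ be the Peterson variety of type $A_{n-1}$, and let $x_1,\ldots,x_n\in H^2(\mathcal{Y};\mathbb{Q})$ be the (negatives of the) first Chern classes of the tautological line bundles. For all integers $1\le a\le c\le b\le n-1$, the following equality holds in $H^*(\mathcal{Y};\mathbb{Q})$: $$x_c\,(x_a x_{a+1}\cdots x_b)=(-1)^{c-a-1}\sum_{i=c}^{b}\binom{i-a}{c-a}\,e_{i-a+1}(x_1,\ldots,x_{i-1})\,x_i x_{i+1}\cdots x_b+(-1)^{c-a}\sum_{i=c}^{b}\binom{i-a}{c-a}\,e_{i-a+1}(x_1,\ldots,x_{i-1})\,x_{i+1}x_{i+2}\cdots x_{b+1}+x_a x_{a+1}\cdots x_{b+1}.$$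
   Context: $Fl(\mathbb{C}^n)$ is the variety of full flags $V_\bullet=(0=V_0\subset V_1\subset\cdots\subset V_n=\mathbb{C}^n)$, $\dim_{\mathbb{C}}V_i=i$. Let $N$ be the $n\times n$ nilpotent matrix consisting of a single Jordan block. The Peterson variety is $\mathcal{Y}=\{V_\bullet\in Fl(\mathbb{C}^n)\mid NV_i\subset V_{i+1}\ (1\le i\le n-1)\}$. Let $U_i$ be the tautological rank-$i$ vector bundle over $Fl(\mathbb{C}^n)$ (fiber $V_i$ over $V_\bullet$), and let $x_i\in H^2(\mathcal{Y};\mathbb{Q})$ be the restriction to $\mathcal{Y}$ of $-c_1(U_i/U_{i-1})$, $1\le i\le n$. Standing identification (known, due to Fukukawa–Harada–Masuda): $H^*(\mathcal{Y};\mathbb{Q})\cong\mathbb{Q}[x_1,\ldots,x_n]/J_x$, with $x_i$ corresponding to the class $x_i$, where $J_x$ is the ideal generated by $(x_1+\cdots+x_k)(x_k-x_{k+1})$ for $1\le k\le n-1$ and $x_1+\cdots+x_n$. $e_k$ denotes the $k$-th elementary symmetric polynomial in the listed variables, with $e_0=1$ (also for an empty list of variables) and $e_k=0$ when $k$ exceeds the number of variables. -}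

module Defs where

open import Algebra.Bundles using (CommutativeRing)
open import Algebra.Structures using (IsCommutativeRing)
open import Data.Fin.Base using (Fin; fromℕ<)
import Data.Fin.Properties as Fin
open import Data.Integer.Base using (ℤ; ∣_∣)
open import Data.List.Base using (List; []; _∷_; _++_; [_]; map; foldr; applyUpTo; cartesianProductWith)
import Data.List.Properties as List
open import Data.Nat.Base using (ℕ; zero; suc; _∸_; _≤_) renaming (_+_ to _+ℕ_)
import Data.Nat.Properties as ℕ
open import Data.Product.Base using (_×_; _,_; Σ)
open import Data.Rational.Base as ℚ using (ℚ; 0ℚ; 1ℚ)
import Data.Rational.Properties as ℚ
open import Data.Vec.Base using (Vec; []; _∷_; zipWith; replicate; tabulate)
import Data.Vec.Properties as Vec
open import Data.Bool.Base using (true; false; if_then_else_)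
open import Data.Empty using (⊥; ⊥-elim)
open import Level using (Level; _⊔_)
open import Relation.Binary.PropositionalEquality using (_≡_; refl; sym; trans; cong; cong₂)
open import Relation.Binary.Structures using (IsEquivalence)
open import Relation.Nullary.Decidable using (Dec; yes; no; does)

-- ℚ[x₁,…,xₙ]: a polynomial is a formal sum of terms (coefficient , exponent
-- vector), with repetitions and zero coefficients allowed; two formal sums are
-- equal when every monomial has the same total coefficient in both.
module MvPolynomial (n : ℕ) where

  Exponent : Set
  Exponent = Vec ℕ n

  Term : Set
  Term = ℚ × Exponent

  Poly : Set
  Poly = List Term

  δ : Exponent → Term → ℚ
  δ m (c , e) = if does (Vec.≡-dec ℕ._≟_ e m) then c else 0ℚ

  coeff : Exponent → Poly → ℚ
  coeff m []      = 0ℚ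
  coeff m (t ∷ p) = δ m t ℚ.+ coeff m p

  infix 4 _≈_

  record _≈_ (p q : Poly) : Set where
    constructor mk≈
    field coeff-≡ : ∀ m → coeff m p ≡ coeff m q

  open _≈_ public

  0ᵉ : Exponent
  0ᵉ = replicate n 0

  _·_ : Term → Term → Term
  (c , e) · (d , f) = c ℚ.* d , zipWith _+ℕ_ e f

  _*ₚ_ : Poly → Poly → Poly
  _*ₚ_ = cartesianProductWith _·_

  -ₜ_ : Term → Term
  -ₜ (c , e) = ℚ.- c , e

  -ₚ_ : Poly → Poly
  -ₚ_ = map -ₜ_

  0ₚ 1ₚ : Poly
  0ₚ = []
  1ₚ = [ 1ℚ , 0ᵉ ]

  var : Fin n → Poly
  var j = [ 1ℚ , tabulate (λ i → if does (i Fin.≟ j) then 1 else 0) ]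

  private
    ≡⇒≈ : ∀ {p q} → p ≡ q → p ≈ q
    ≡⇒≈ refl = mk≈ λ _ → refl

    ≈-isEquivalence : IsEquivalence _≈_
    ≈-isEquivalence = record
      { refl  = mk≈ λ _ → refl
      ; sym   = λ h → mk≈ λ m → sym (coeff-≡ h m)
      ; trans = λ h k → mk≈ λ m → trans (coeff-≡ h m) (coeff-≡ k m)
      }

    open IsEquivalence ≈-isEquivalence using () renaming (refl to ≈-refl; sym to ≈-sym; trans to ≈-trans)

    coeff-++ : ∀ m p q → coeff m (p ++ q) ≡ coeff m p ℚ.+ coeff m q
    coeff-++ m []      q = sym (ℚ.+-identityˡ _)
    coeff-++ m (t ∷ p) q = trans (cong (δ m t ℚ.+_) (coeff-++ m p q)) (sym (ℚ.+-assoc (δ m t) (coeff m p) (coeff m q)))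

    ++-cong : ∀ {p p′ q q′} → p ≈ p′ → q ≈ q′ → (p ++ q) ≈ (p′ ++ q′)
    ++-cong {p} {p′} {q} {q′} h k = mk≈ λ m →
      trans (coeff-++ m p q) (trans (cong₂ ℚ._+_ (coeff-≡ h m) (coeff-≡ k m)) (sym (coeff-++ m p′ q′)))

    ++-comm : ∀ p q → (p ++ q) ≈ (q ++ p)
    ++-comm p q = mk≈ λ m →
      trans (coeff-++ m p q) (trans (ℚ.+-comm (coeff m p) (coeff m q)) (sym (coeff-++ m q p)))

    δ-neg : ∀ m t → δ m (-ₜ t) ≡ ℚ.- δ m t
    δ-neg m (c , e) with does (Vec.≡-dec ℕ._≟_ e m)
    ... | true  = refl
    ... | false = refl

    coeff-neg : ∀ m p → coeff m (-ₚ p) ≡ ℚ.- coeff m p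
    coeff-neg m []      = refl
    coeff-neg m (t ∷ p) = trans (cong₂ ℚ._+_ (δ-neg m t) (coeff-neg m p)) (sym (ℚ.neg-distrib-+ (δ m t) (coeff m p)))

    neg-cong : ∀ {p q} → p ≈ q → (-ₚ p) ≈ (-ₚ q)
    neg-cong {p} {q} h = mk≈ λ m → trans (coeff-neg m p) (trans (cong ℚ.-_ (coeff-≡ h m)) (sym (coeff-neg m q)))

    neg-inverseˡ : ∀ p → ((-ₚ p) ++ p) ≈ 0ₚ
    neg-inverseˡ p = mk≈ λ m →
      trans (coeff-++ m (-ₚ p) p) (trans (cong (ℚ._+ coeff m p) (coeff-neg m p)) (ℚ.+-inverseˡ (coeff m p)))

    neg-inverseʳ : ∀ p → (p ++ (-ₚ p)) ≈ 0ₚ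
    neg-inverseʳ p = ≈-trans (++-comm p (-ₚ p)) (neg-inverseˡ p)

    ·-assoc : ∀ s t u → (s · t) · u ≡ s · (t · u)
    ·-assoc (c , e) (d , f) (b , g) = cong₂ _,_ (ℚ.*-assoc c d b) (Vec.zipWith-assoc ℕ.+-assoc e f g)

    ·-comm : ∀ s t → s · t ≡ t · s
    ·-comm (c , e) (d , f) = cong₂ _,_ (ℚ.*-comm c d) (Vec.zipWith-comm ℕ.+-comm e f)

    ·-identityˡ : ∀ t → (1ℚ , 0ᵉ) · t ≡ t
    ·-identityˡ (c , e) = cong₂ _,_ (ℚ.*-identityˡ c) (Vec.zipWith-identityˡ ℕ.+-identityˡ e)

    *-++ : ∀ p q r → (p ++ q) *ₚ r ≡ (p *ₚ r) ++ (q *ₚ r)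
    *-++ []      q r = refl
    *-++ (t ∷ p) q r = trans (cong (map (t ·_) r ++_) (*-++ p q r)) (sym (List.++-assoc (map (t ·_) r) (p *ₚ r) (q *ₚ r)))

    map-·-· : ∀ s t r → map ((s · t) ·_) r ≡ map (s ·_) (map (t ·_) r)
    map-·-· s t []      = refl
    map-·-· s t (u ∷ r) = cong₂ _∷_ (·-assoc s t u) (map-·-· s t r)

    map-* : ∀ t q r → map (t ·_) q *ₚ r ≡ map (t ·_) (q *ₚ r)
    map-* t []      r = refl
    map-* t (u ∷ q) r = trans (cong₂ _++_ (map-·-· t u r) (map-* t q r)) (sym (List.map-++ (t ·_) (map (u ·_) r) (q *ₚ r)))

    *-assoc : ∀ p q r → (p *ₚ q) *ₚ r ≡ p *ₚ (q *ₚ r)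
    *-assoc []      q r = refl
    *-assoc (t ∷ p) q r = trans (*-++ (map (t ·_) q) (p *ₚ q) r) (cong₂ _++_ (map-* t q r) (*-assoc p q r))

    *-identityˡ : ∀ p → 1ₚ *ₚ p ≡ p
    *-identityˡ p = trans (List.++-identityʳ _) (go p)
      where
      go : ∀ q → map ((1ℚ , 0ᵉ) ·_) q ≡ q
      go []      = refl
      go (t ∷ q) = cong₂ _∷_ (·-identityˡ t) (go q)

    *-zeroʳ : ∀ p → p *ₚ [] ≡ []
    *-zeroʳ []      = refl
    *-zeroʳ (t ∷ p) = *-zeroʳ p

    swap-++ : ∀ p q r → (p ++ (q ++ r)) ≈ (q ++ (p ++ r))
    swap-++ p q r = ≈-trans (≡⇒≈ (sym (List.++-assoc p q r)))
      (≈-trans (++-cong (++-comm p q) (≈-refl {r})) (≡⇒≈ (List.++-assoc q p r)))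

    *-∷ʳ : ∀ p t q → (p *ₚ (t ∷ q)) ≈ (map (t ·_) p ++ (p *ₚ q))
    *-∷ʳ []      t q = ≈-refl
    *-∷ʳ (s ∷ p) t q = ++-cong {[ s · t ]} {[ t · s ]} (≡⇒≈ (cong [_] (·-comm s t)))
      (≈-trans (++-cong (≈-refl {map (s ·_) q}) (*-∷ʳ p t q))
               (swap-++ (map (s ·_) q) (map (t ·_) p) (p *ₚ q)))

    *-comm : ∀ p q → (p *ₚ q) ≈ (q *ₚ p)
    *-comm []      q = ≡⇒≈ (sym (*-zeroʳ q))
    *-comm (t ∷ p) q = ≈-trans (++-cong (≈-refl {map (t ·_) q}) (*-comm p q)) (≈-sym (*-∷ʳ q t p))

    subtract? : ∀ {k} (e m : Vec ℕ k) → Dec (Σ (Vec ℕ k) λ f → zipWith _+ℕ_ e f ≡ m)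
    subtract? []      []      = yes ([] , refl)
    subtract? (i ∷ e) (j ∷ m) with i ℕ.≤? j | subtract? e m
    ... | yes i≤j | yes (f , eq) = yes ((j ∸ i) ∷ f , cong₂ _∷_ (ℕ.m+[n∸m]≡n i≤j) eq)
    ... | yes _   | no ¬f        = no λ { (_ ∷ f , eq) → ¬f (f , Vec.∷-injectiveʳ eq) }
    ... | no i≰j  | _            = no λ { (l ∷ _ , eq) → i≰j (ℕ.≤-trans (ℕ.m≤m+n i l) (ℕ.≤-reflexive (Vec.∷-injectiveˡ eq))) }

    +-cancelˡ : ∀ {k} (e f g : Vec ℕ k) → zipWith _+ℕ_ e f ≡ zipWith _+ℕ_ e g → f ≡ g
    +-cancelˡ []      []      []      _  = refl
    +-cancelˡ (i ∷ e) (j ∷ f) (l ∷ g) eq =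
      cong₂ _∷_ (ℕ.+-cancelˡ-≡ i j l (Vec.∷-injectiveˡ eq)) (+-cancelˡ e f g (Vec.∷-injectiveʳ eq))

    δ-· : ∀ c e f t → δ (zipWith _+ℕ_ e f) ((c , e) · t) ≡ c ℚ.* δ f t
    δ-· c e f (d , g) with Vec.≡-dec ℕ._≟_ (zipWith _+ℕ_ e g) (zipWith _+ℕ_ e f) | Vec.≡-dec ℕ._≟_ g f
    ... | yes _  | yes _    = refl
    ... | no _   | no _     = sym (ℚ.*-zeroʳ c)
    ... | yes eq | no g≢f   = ⊥-elim (g≢f (+-cancelˡ e g f eq))
    ... | no neq | yes refl = ⊥-elim (neq refl)

    coeff-map : ∀ c e f q → coeff (zipWith _+ℕ_ e f) (map ((c , e) ·_) q) ≡ c ℚ.* coeff f q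
    coeff-map c e f []      = sym (ℚ.*-zeroʳ c)
    coeff-map c e f (t ∷ q) = trans (cong₂ ℚ._+_ (δ-· c e f t) (coeff-map c e f q)) (sym (ℚ.*-distribˡ-+ c (δ f t) (coeff f q)))

    coeff-map-0 : ∀ c e m q → (∀ f → zipWith _+ℕ_ e f ≡ m → ⊥) → coeff m (map ((c , e) ·_) q) ≡ 0ℚ
    coeff-map-0 c e m []            h = refl
    coeff-map-0 c e m ((d , g) ∷ q) h with Vec.≡-dec ℕ._≟_ (zipWith _+ℕ_ e g) m
    ... | yes eq = ⊥-elim (h g eq)
    ... | no _   = trans (ℚ.+-identityˡ _) (coeff-map-0 c e m q h)

    map-cong : ∀ t {q q′} → q ≈ q′ → map (t ·_) q ≈ map (t ·_) q′
    map-cong (c , e) {q} {q′} h = mk≈ λ m → go m (subtract? e m)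
      where
      go : ∀ m → Dec (Σ Exponent λ f → zipWith _+ℕ_ e f ≡ m) →
           coeff m (map ((c , e) ·_) q) ≡ coeff m (map ((c , e) ·_) q′)
      go _ (yes (f , refl)) = trans (coeff-map c e f q) (trans (cong (c ℚ.*_) (coeff-≡ h f)) (sym (coeff-map c e f q′)))
      go m (no ¬f)          = trans (coeff-map-0 c e m q λ f eq → ¬f (f , eq)) (sym (coeff-map-0 c e m q′ λ f eq → ¬f (f , eq)))

    *-congˡ : ∀ p {q q′} → q ≈ q′ → (p *ₚ q) ≈ (p *ₚ q′)
    *-congˡ []      h = ≈-refl
    *-congˡ (t ∷ p) h = ++-cong (map-cong t h) (*-congˡ p h)

    *-cong : ∀ {p p′ q q′} → p ≈ p′ → q ≈ q′ → (p *ₚ q) ≈ (p′ *ₚ q′)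
    *-cong {p} {p′} {q} {q′} h k =
      ≈-trans (*-congˡ p k) (≈-trans (*-comm p q′) (≈-trans (*-congˡ q′ h) (*-comm q′ p′)))

    *-distribˡ : ∀ p q r → (p *ₚ (q ++ r)) ≈ ((p *ₚ q) ++ (p *ₚ r))
    *-distribˡ p q r = ≈-trans (*-comm p (q ++ r)) (≈-trans (≡⇒≈ (*-++ q r p)) (++-cong (*-comm q p) (*-comm r p)))

    isCommutativeRing : IsCommutativeRing _≈_ _++_ _*ₚ_ -ₚ_ 0ₚ 1ₚ
    isCommutativeRing = record
      { isRing = record
        { +-isAbelianGroup = record
          { isGroup = record
            { isMonoid = record
              { isSemigroup = record
                { isMagma = record { isEquivalence = ≈-isEquivalence ; ∙-cong = ++-cong }
                ; assoc = λ p q r → ≡⇒≈ (List.++-assoc p q r)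
                }
              ; identity = (λ _ → ≈-refl) , (λ p → ≡⇒≈ (List.++-identityʳ p))
              }
            ; inverse = neg-inverseˡ , neg-inverseʳ
            ; ⁻¹-cong = neg-cong
            }
          ; comm = ++-comm
          }
        ; *-cong = *-cong
        ; *-assoc = λ p q r → ≡⇒≈ (*-assoc p q r)
        ; *-identity = (λ p → ≡⇒≈ (*-identityˡ p)) , (λ p → ≈-trans (*-comm p 1ₚ) (≡⇒≈ (*-identityˡ p)))
        ; distrib = *-distribˡ , (λ p q r → ≡⇒≈ (*-++ q r p))
        }
      ; *-comm = *-comm
      }

  commutativeRing : CommutativeRing _ _
  commutativeRing = record { isCommutativeRing = isCommutativeRing }

module _ {c ℓ g : Level} (R : CommutativeRing c ℓ) (G : CommutativeRing.Carrier R → Set g) where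

  private
    module R = CommutativeRing R
  open R using (Carrier; _+_; _*_; _-_; -_; 0#; 1#)
  open import Algebra.Properties.Ring R.ring using (-1*x≈-x; x[y-z]≈xy-xz)
  open import Algebra.Properties.AbelianGroup R.+-abelianGroup using (⁻¹-anti-homo‿-; ⁻¹-∙-comm)
  open import Algebra.Properties.CommutativeSemigroup R.+-commutativeSemigroup using (interchange)
  open import Relation.Binary.Reasoning.Setoid R.setoid

  -- The smallest ideal of R containing every x with G x.
  data GeneratedIdeal : Carrier → Set (c ⊔ ℓ ⊔ g) where
    gen  : ∀ {x} → G x → GeneratedIdeal x
    zero : GeneratedIdeal 0#
    add  : ∀ {x y} → GeneratedIdeal x → GeneratedIdeal y → GeneratedIdeal (x + y)
    mul  : ∀ r {x} → GeneratedIdeal x → GeneratedIdeal (r * x)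
    resp : ∀ {x y} → x R.≈ y → GeneratedIdeal x → GeneratedIdeal y

  record CongruentMod (x y : Carrier) : Set (c ⊔ ℓ ⊔ g) where
    constructor mkMod
    field difference : GeneratedIdeal (x - y)

  open CongruentMod

  private
    telescope : ∀ x y z → (x - y) + (y - z) R.≈ x - z
    telescope x y z = begin
      (x - y) + (y - z)   ≈⟨ R.+-assoc x (- y) (y - z) ⟩
      x + (- y + (y - z)) ≈⟨ R.+-congˡ (R.+-assoc (- y) y (- z)) ⟨
      x + ((- y + y) - z) ≈⟨ R.+-congˡ (R.+-congʳ (R.-‿inverseˡ y)) ⟩
      x + (0# - z)        ≈⟨ R.+-congˡ (R.+-identityˡ (- z)) ⟩
      x - z               ∎

    ≈⇒mod : ∀ {x y} → x R.≈ y → CongruentMod x y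
    ≈⇒mod {x} {y} h = mkMod (resp (R.sym (R.trans (R.+-congʳ h) (R.-‿inverseʳ y))) zero)

    negate : ∀ {x y} → GeneratedIdeal (x - y) → GeneratedIdeal (y - x)
    negate {x} {y} h = resp (R.trans (-1*x≈-x (x - y)) (⁻¹-anti-homo‿- x y)) (mul (- 1#) h)

    mod-isEquivalence : IsEquivalence CongruentMod
    mod-isEquivalence = record
      { refl  = ≈⇒mod R.refl
      ; sym   = λ h → mkMod (negate (difference h))
      ; trans = λ {x} {y} {z} h k → mkMod (resp (telescope x y z) (add (difference h) (difference k)))
      }

    +-cong : ∀ {x x′ y y′} → CongruentMod x x′ → CongruentMod y y′ → CongruentMod (x + y) (x′ + y′)
    +-cong {x} {x′} {y} {y′} h k = mkMod (resp
      (R.trans (interchange x (- x′) y (- y′)) (R.+-congˡ (⁻¹-∙-comm x′ y′)))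
      (add (difference h) (difference k)))

    *-cong : ∀ {x x′ y y′} → CongruentMod x x′ → CongruentMod y y′ → CongruentMod (x * y) (x′ * y′)
    *-cong {x} {x′} {y} {y′} h k = mkMod (resp eq (add (mul y (difference h)) (mul x′ (difference k))))
      where
      eq : y * (x - x′) + x′ * (y - y′) R.≈ x * y - x′ * y′
      eq = begin
        y * (x - x′) + x′ * (y - y′)              ≈⟨ R.+-cong (x[y-z]≈xy-xz y x x′) (x[y-z]≈xy-xz x′ y y′) ⟩
        (y * x - y * x′) + (x′ * y - x′ * y′)     ≈⟨ R.+-congʳ (R.+-cong (R.*-comm y x) (R.-‿cong (R.*-comm y x′))) ⟩
        (x * y - x′ * y) + (x′ * y - x′ * y′)     ≈⟨ telescope (x * y) (x′ * y) (x′ * y′) ⟩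
        x * y - x′ * y′                           ∎

    neg-cong : ∀ {x y} → CongruentMod x y → CongruentMod (- x) (- y)
    neg-cong {x} {y} h = mkMod (resp
      (R.trans (-1*x≈-x (x - y)) (R.sym (⁻¹-∙-comm x (- y))))
      (mul (- 1#) (difference h)))

  -- R / (G): the carrier and operations of R, with equality coarsened to
  -- congruence modulo the ideal.
  quotient : CommutativeRing c (c ⊔ ℓ ⊔ g)
  quotient = record
    { Carrier = Carrier ; _≈_ = CongruentMod
    ; _+_ = _+_ ; _*_ = _*_ ; -_ = -_ ; 0# = 0# ; 1# = 1#
    ; isCommutativeRing = record
      { isRing = record
        { +-isAbelianGroup = record
          { isGroup = record
            { isMonoid = record
              { isSemigroup = record
                { isMagma = record { isEquivalence = mod-isEquivalence ; ∙-cong = +-cong }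
                ; assoc = λ x y z → ≈⇒mod (R.+-assoc x y z)
                }
              ; identity = (λ x → ≈⇒mod (R.+-identityˡ x)) , (λ x → ≈⇒mod (R.+-identityʳ x))
              }
            ; inverse = (λ x → ≈⇒mod (R.-‿inverseˡ x)) , (λ x → ≈⇒mod (R.-‿inverseʳ x))
            ; ⁻¹-cong = neg-cong
            }
          ; comm = λ x y → ≈⇒mod (R.+-comm x y)
          }
        ; *-cong = *-cong
        ; *-assoc = λ x y z → ≈⇒mod (R.*-assoc x y z)
        ; *-identity = (λ x → ≈⇒mod (R.*-identityˡ x)) , (λ x → ≈⇒mod (R.*-identityʳ x))
        ; distrib = (λ x y z → ≈⇒mod (R.distribˡ x y z)) , (λ x y z → ≈⇒mod (R.distribʳ x y z))
        }
      ; *-comm = λ x y → ≈⇒mod (R.*-comm x y)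
      }
    }

-- lo, lo+1, …, hi; empty when hi < lo.
[_⋯_] : ℕ → ℕ → List ℕ
[ lo ⋯ hi ] = applyUpTo (lo +ℕ_) (suc hi ∸ lo)

-- All k-element subfamilies of a list, by position.
choose : ∀ {a} {A : Set a} → ℕ → List A → List (List A)
choose zero    _        = [ [] ]
choose (suc k) []       = []
choose (suc k) (x ∷ xs) = map (x ∷_) (choose k xs) ++ choose (suc k) xs

module RingNotation {c ℓ : Level} (R : CommutativeRing c ℓ) where

  open CommutativeRing R using (Carrier; _+_; _*_; -_; 0#; 1#; semiring)
  open import Algebra.Properties.Semiring.Exp semiring using (_^_)

  sum product : List Carrier → Carrier
  sum     = foldr _+_ 0#
  product = foldr _*_ 1#

  ∑ ∏ : ℕ → ℕ → (ℕ → Carrier) → Carrier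
  ∑ lo hi f = sum (map f [ lo ⋯ hi ])
  ∏ lo hi f = product (map f [ lo ⋯ hi ])

  infix 6 ∑ ∏
  syntax ∑ lo hi (λ i → t) = ∑[ lo ≤ i ≤ hi ] t
  syntax ∏ lo hi (λ i → t) = ∏[ lo ≤ i ≤ hi ] t

  e : ℕ → List Carrier → Carrier
  e k xs = sum (map product (choose k xs))

  -- The exponent is an integer because it may be -1; (-1)^(-k) = (-1)^k.
  [-1]^_ : ℤ → Carrier
  [-1]^ z = (- 1#) ^ ∣ z ∣

module Peterson (n : ℕ) where

  open MvPolynomial n using (Poly; var; 0ₚ) renaming (commutativeRing to ℚ[x]) public

  -- 1-based: x i is the i-th variable for 1 ≤ i ≤ n, and the junk value 0 otherwise.
  x : ℕ → Poly
  x zero    = 0ₚ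
  x (suc i) with i ℕ.<? n
  ... | yes i<n = var (fromℕ< i<n)
  ... | no  _   = 0ₚ

  private
    module P where
      open CommutativeRing ℚ[x] public using (_*_; _-_)
      open RingNotation ℚ[x] public using (∑)

  data Generator : Poly → Set where
    quadratic : ∀ k → 1 ≤ k → k ≤ n ∸ 1 → Generator (P.∑ 1 k x P.* (x k P.- x (suc k)))
    linear    : Generator (P.∑ 1 n x)

  -- H*(𝒴; ℚ) through the Fukukawa–Harada–Masuda presentation ℚ[x₁,…,xₙ] / Jₓ.
  H* : CommutativeRing _ _
  H* = quotient ℚ[x] Generator

  open CommutativeRing H* public using (_≈_; _+_; _*_)
  open RingNotation H* public
  open import Algebra.Properties.Semiring.Mult (CommutativeRing.semiring H*) public using () renaming (_×_ to _·_)

{-# OPTIONS --safe #-}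
module Submission where

-- Write s_j = x_1 + ⋯ + x_j, d_b = x_b - x_{b+1}, P(i,b) = x_i ⋯ x_b, so that s_j d_j = 0 for j < n.
-- Descending on j from b, the relations give s_j P(j+1,b) d_b = -(b-j) P(j,b) d_b, and an induction on j
-- gives k e_k(x_1,…,x_j) = s_j e_{k-1}(x_1,…,x_{j-1}).  Together, after dividing by k,
--   e_k(x_1,…,x_{a+k-1}) P(a+k,b) d_b = (-1)^k C(b-a,k) P(a,b) d_b,
-- whence, by Pascal's rule,
--   e_{k+1}(x_1,…,x_{a+k-1}) P(a+k+1,b) d_b = (-1)^{k+1} C(b-a+1,k+1) P(a,b) d_b.
-- The theorem says that (x_c - x_{b+1}) P(a,b) equals
--   (-1)^{c-a-1} ∑_i C(i-a,c-a) e_{i-a+1}(x_1,…,x_{i-1}) (P(i,b) - P(i+1,b+1)).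
-- Induct on b from b = c-1, where both sides vanish.  Passing from b-1 to b multiplies each side by x_b and
-- adds P(a,b) d_b on the left and a combination of the terms above on the right; these agree because
-- ∑_k (-1)^k C(k,m) C(N+1,k+1) = (-1)^m for m ≤ N.

open import Defs
open import Algebra.Bundles using (CommutativeRing)
open import Data.Nat.Base using (ℕ; zero; suc; _∸_; _≤_; _<_; z≤n; s≤s; s≤s⁻¹)
import Data.Nat.Base as ℕ
import Data.Nat.Properties as ℕ
open import Data.Nat.Combinatorics using (_C_; nCk+nC[k+1]≡[n+1]C[k+1]; k>n⇒nCk≡0)
open import Data.Nat.Tactic.RingSolver using (solve-∀)
open import Data.Bool.Base using (true; false)
open import Data.Integer.Base using (+_) renaming (_-_ to _-ℤ_)
import Data.Integer.Properties as ℤ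
open import Data.List.Base using ([]; _∷_; _∷ʳ_; map; _++_; applyUpTo)
import Data.List.Properties as List
open import Data.Product.Base using (∃; _,_)
open import Data.Rational.Base as ℚ using (ℚ; 0ℚ; 1ℚ)
import Data.Rational.Properties as ℚ
import Data.Vec.Properties as Vec
open import Function.Base using (_∘_)
open import Relation.Nullary.Decidable using (does)
open import Relation.Binary.PropositionalEquality as ≡ using (_≡_)

-- Binomial coefficients and integer exponents.

-- The rule (k+1) C(n,k+1) = (n-k) C(n,k) with k C(n,k) moved to the left, so that no truncated
-- subtraction occurs. Induction on n expands the coefficients by Pascal's rule.
C-absorption : ∀ n k → suc k ℕ.* (n C suc k) ℕ.+ k ℕ.* (n C k) ≡ n ℕ.* (n C k)
C-absorption zero    zero    = ≡.refl
C-absorption zero    (suc k) = ≡.cong₂ ℕ._+_ (ℕ.*-zeroʳ (2 ℕ.+ k)) (ℕ.*-zeroʳ k)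
C-absorption (suc n) zero    = begin
  1 ℕ.* (suc n C 1) ℕ.+ 0           ≡⟨ ≡.cong (λ t → 1 ℕ.* t ℕ.+ 0) (nCk+nC[k+1]≡[n+1]C[k+1] n 0) ⟨
  1 ℕ.* (1 ℕ.+ (n C 1)) ℕ.+ 0       ≡⟨ lemma (n C 1) ⟩
  1 ℕ.+ (1 ℕ.* (n C 1) ℕ.+ 0)       ≡⟨ ≡.cong suc (C-absorption n 0) ⟩
  1 ℕ.+ n ℕ.* 1                     ∎
  where
  open ≡.≡-Reasoning
  lemma : ∀ t → 1 ℕ.* (1 ℕ.+ t) ℕ.+ 0 ≡ 1 ℕ.+ (1 ℕ.* t ℕ.+ 0)
  lemma = solve-∀
C-absorption (suc n) (suc k) = begin
  (2 ℕ.+ k) ℕ.* (suc n C (2 ℕ.+ k)) ℕ.+ (1 ℕ.+ k) ℕ.* (suc n C suc k)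
    ≡⟨ ≡.cong₂ (λ s t → (2 ℕ.+ k) ℕ.* s ℕ.+ (1 ℕ.+ k) ℕ.* t) (nCk+nC[k+1]≡[n+1]C[k+1] n (suc k)) (nCk+nC[k+1]≡[n+1]C[k+1] n k) ⟨
  (2 ℕ.+ k) ℕ.* (v ℕ.+ w) ℕ.+ (1 ℕ.+ k) ℕ.* (u ℕ.+ v)
    ≡⟨ expand k u v w ⟩
  ((2 ℕ.+ k) ℕ.* w ℕ.+ (1 ℕ.+ k) ℕ.* v) ℕ.+ ((1 ℕ.+ k) ℕ.* v ℕ.+ k ℕ.* u) ℕ.+ (u ℕ.+ v)
    ≡⟨ ≡.cong₂ (λ s t → s ℕ.+ t ℕ.+ (u ℕ.+ v)) (C-absorption n (suc k)) (C-absorption n k) ⟩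
  n ℕ.* v ℕ.+ n ℕ.* u ℕ.+ (u ℕ.+ v)
    ≡⟨ collect n u v ⟩
  suc n ℕ.* (u ℕ.+ v)
    ≡⟨ ≡.cong (suc n ℕ.*_) (nCk+nC[k+1]≡[n+1]C[k+1] n k) ⟩
  suc n ℕ.* (suc n C suc k) ∎
  where
  open ≡.≡-Reasoning
  u = n C k
  v = n C suc k
  w = n C (2 ℕ.+ k)
  expand : ∀ k u v w → (2 ℕ.+ k) ℕ.* (v ℕ.+ w) ℕ.+ (1 ℕ.+ k) ℕ.* (u ℕ.+ v)
         ≡ ((2 ℕ.+ k) ℕ.* w ℕ.+ (1 ℕ.+ k) ℕ.* v) ℕ.+ ((1 ℕ.+ k) ℕ.* v ℕ.+ k ℕ.* u) ℕ.+ (u ℕ.+ v)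
  expand = solve-∀
  collect : ∀ n u v → n ℕ.* v ℕ.+ n ℕ.* u ℕ.+ (u ℕ.+ v) ≡ suc n ℕ.* (u ℕ.+ v)
  collect = solve-∀

[k+1]*nC[k+1]≡[n∸k]*nCk : ∀ k r → suc k ℕ.* ((k ℕ.+ r) C suc k) ≡ r ℕ.* ((k ℕ.+ r) C k)
[k+1]*nC[k+1]≡[n∸k]*nCk k r = ℕ.+-cancelʳ-≡ (k ℕ.* c) _ _
  (≡.trans (C-absorption (k ℕ.+ r) k) (≡.trans (ℕ.*-distribʳ-+ c k r) (ℕ.+-comm (k ℕ.* c) (r ℕ.* c))))
  where c = (k ℕ.+ r) C k

[+a+m]-[+a]≡+m : ∀ a m → + (a ℕ.+ m) -ℤ + a ≡ + m
[+a+m]-[+a]≡+m a m = ≡.trans (ℤ.m-n≡m⊖n (a ℕ.+ m) a)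
  (≡.trans (ℤ.⊖-≥ (ℕ.m≤m+n a m)) (≡.cong +_ (ℕ.m+n∸m≡n a m)))

-- Signs, numerals and finite sums in a commutative ring.

module RingIdentities {c ℓ} (R : CommutativeRing c ℓ) where

  open CommutativeRing R
  open RingNotation R
  open import Algebra.Properties.Ring ring using (-1*x≈-x; -‿involutive)
  open import Algebra.Properties.Semiring.Exp semiring using (_^_)
  open import Algebra.Properties.Semiring.Mult semiring using (_×_; ×-congˡ; ×-congʳ; ×-homo-+; ×-assoc-*; ×1-homo-*)
  open import Algebra.Solver.Ring.NaturalCoefficients.Default commutativeSemiring using (solve; _:=_; _:+_; _:*_; con)
  open import Relation.Binary.Reasoning.Setoid setoid

  -- Keeping -1 as an atom ε with ε + 1 = 0 leaves only semiring identities for the solver.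
  ε : Carrier
  ε = - 1#

  [_] : ℕ → Carrier
  [ k ] = k × 1#

  ε-inverse : ∀ y → y + ε * y ≈ 0#
  ε-inverse y = trans (+-congˡ (-1*x≈-x y)) (-‿inverseʳ y)

  ε*ε≈1 : ε * ε ≈ 1#
  ε*ε≈1 = trans (-1*x≈-x ε) (-‿involutive 1#)

  sign² : ∀ k → ε ^ k * ε ^ k ≈ 1#
  sign² zero    = *-identityˡ 1#
  sign² (suc k) = trans (solve 2 (λ e g → (e :* g) :* (e :* g) := (e :* e) :* (g :* g)) refl ε (ε ^ k))
    (trans (*-cong ε*ε≈1 (sign² k)) (*-identityˡ 1#))

  -- `[-1]^_` reads the absolute value of its exponent, so m = 0 gives exponent -1 and the value
  -- `ε`; for m > 0 two of the signs cancel.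
  [-1]^[m-1] : ∀ m → ε * ε ^ m ≈ [-1]^ (+ m -ℤ + 1)
  [-1]^[m-1] zero    = refl
  [-1]^[m-1] (suc m) = trans (sym (*-assoc ε ε (ε ^ m))) (trans (*-congʳ ε*ε≈1) (*-identityˡ (ε ^ m)))

  +-transpose : ∀ {y z w} → y + z ≈ w → y ≈ w + ε * z
  +-transpose {y} {z} {w} h = begin
    y                  ≈⟨ +-identityʳ y ⟨
    y + 0#             ≈⟨ +-congˡ (ε-inverse z) ⟨
    y + (z + ε * z)    ≈⟨ +-assoc y z (ε * z) ⟨
    y + z + ε * z      ≈⟨ +-congʳ h ⟩
    w + ε * z          ∎

  ×≈[]* : ∀ k y → k × y ≈ [ k ] * y
  ×≈[]* k y = trans (×-congʳ k (sym (*-identityˡ y))) (sym (×-assoc-* k 1# y))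

  opaque
    -- Sums indexed from 0 by their number of terms. Being opaque, they are unfolded only by the
    -- lemmas of this block.
    ∑< : ℕ → (ℕ → Carrier) → Carrier
    ∑< n f = sum (applyUpTo f n)

    ∑<-head : ∀ n f → ∑< (suc n) f ≡ f 0 + ∑< n (f ∘ suc)
    ∑<-head n f = ≡.refl

    ∑<-cong : ∀ n {f g} → (∀ k → k < n → f k ≈ g k) → ∑< n f ≈ ∑< n g
    ∑<-cong zero    h = refl
    ∑<-cong (suc n) h = +-cong (h 0 (s≤s z≤n)) (∑<-cong n λ k k<n → h (suc k) (s≤s k<n))

    ∑<-zero : ∀ n {f} → (∀ k → k < n → f k ≈ 0#) → ∑< n f ≈ 0#
    ∑<-zero zero    h = refl
    ∑<-zero (suc n) h = trans (+-cong (h 0 (s≤s z≤n)) (∑<-zero n λ k k<n → h (suc k) (s≤s k<n))) (+-identityˡ 0#)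

    ∑<-+ : ∀ n f g → ∑< n (λ k → f k + g k) ≈ ∑< n f + ∑< n g
    ∑<-+ zero    f g = sym (+-identityˡ 0#)
    ∑<-+ (suc n) f g = trans (+-congˡ (∑<-+ n (f ∘ suc) (g ∘ suc)))
      (solve 4 (λ p q r s → p :+ q :+ (r :+ s) := p :+ r :+ (q :+ s)) refl (f 0) (g 0) _ _)

    ∑<-* : ∀ n y f → ∑< n (λ k → y * f k) ≈ y * ∑< n f
    ∑<-* zero    y f = sym (zeroʳ y)
    ∑<-* (suc n) y f = trans (+-congˡ (∑<-* n y (f ∘ suc))) (sym (distribˡ y (f 0) _))

    ∑<-++ : ∀ m n f → ∑< (m ℕ.+ n) f ≈ ∑< m f + ∑< n (λ k → f (m ℕ.+ k))
    ∑<-++ zero    n f = sym (+-identityˡ _)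
    ∑<-++ (suc m) n f = trans (+-congˡ (∑<-++ m n (f ∘ suc))) (sym (+-assoc (f 0) _ _))

    ∑<-suc : ∀ n f → ∑< (suc n) f ≈ ∑< n f + f n
    ∑<-suc zero    f = +-comm (f 0) 0#
    ∑<-suc (suc n) f = trans (+-congˡ (∑<-suc n (f ∘ suc))) (sym (+-assoc (f 0) _ _))

    ∑≈∑< : ∀ lo l f → ∑ lo (lo ℕ.+ l) f ≈ ∑< (suc l) (λ k → f (lo ℕ.+ k))
    ∑≈∑< lo l f = reflexive (≡.cong sum (≡.trans
      (List.map-applyUpTo (lo ℕ.+_) f (suc (lo ℕ.+ l) ∸ lo))
      (≡.cong (applyUpTo (λ k → f (lo ℕ.+ k))) (≡.trans (ℕ.+-∸-assoc 1 (ℕ.m≤m+n lo l)) (≡.cong suc (ℕ.m+n∸m≡n lo l))))))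

  -- An alternating sum of products of binomial coefficients.

  private
    B : ℕ → (ℕ → Carrier) → Carrier
    B n f = ∑< (suc n) (λ k → ε ^ k * [ suc n C suc k ] * f k)

  pascal : ∀ n k → [ suc n C suc k ] ≈ [ n C k ] + [ n C suc k ]
  pascal n k = trans (×-congˡ (≡.sym (nCk+nC[k+1]≡[n+1]C[k+1] n k))) (×-homo-+ 1# (n C k) (n C suc k))

  C-vanish : ∀ {n k} → n < k → [ n C k ] ≈ 0#
  C-vanish n<k = ×-congˡ (k>n⇒nCk≡0 n<k)

  private
    B-suc : ∀ n f → B (suc n) f ≈ f 0 + B n (λ k → f k + ε * f (suc k))
    B-suc n f = begin
      B (suc n) f
        ≈⟨ ∑<-cong (2 ℕ.+ n) (λ k _ → trans (*-congʳ (*-congˡ (pascal (suc n) k)))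
             (solve 4 (λ s u v w → s :* (u :+ v) :* w := s :* u :* w :+ s :* v :* w) refl (ε ^ k) _ _ (f k))) ⟩
      ∑< (2 ℕ.+ n) (λ k → ε ^ k * [ suc n C k ] * f k + ε ^ k * [ suc n C suc k ] * f k)
        ≈⟨ ∑<-+ (2 ℕ.+ n) (λ k → ε ^ k * [ suc n C k ] * f k) g ⟩
      ∑< (2 ℕ.+ n) (λ k → ε ^ k * [ suc n C k ] * f k) + ∑< (2 ℕ.+ n) g
        ≡⟨ ≡.cong (_+ ∑< (2 ℕ.+ n) g) (∑<-head (suc n) _) ⟩
      (1# * (1# + 0#) * f 0 + ∑< (suc n) (λ k → ε ^ suc k * [ suc n C suc k ] * f (suc k))) + ∑< (2 ℕ.+ n) g
        ≈⟨ +-cong (+-cong (solve 1 (λ y → con 1 :* (con 1 :+ con 0) :* y := y) refl (f 0))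
             (∑<-cong (suc n) λ k _ → solve 4 (λ e s u w → e :* s :* u :* w := s :* u :* (e :* w)) refl ε (ε ^ k) _ (f (suc k))))
             -- The top summand of `g` drops out, since C(n+1,n+2) = 0.
             (trans (∑<-suc (suc n) g) (trans (+-congˡ (trans (*-congʳ (trans (*-congˡ (C-vanish (ℕ.n<1+n (suc n)))) (zeroʳ _))) (zeroˡ _))) (+-identityʳ _))) ⟩
      (f 0 + ∑< (suc n) (λ k → ε ^ k * [ suc n C suc k ] * (ε * f (suc k)))) + B n f
        ≈⟨ solve 3 (λ p q r → p :+ q :+ r := p :+ (r :+ q)) refl (f 0) _ (B n f) ⟩
      f 0 + (B n f + ∑< (suc n) (λ k → ε ^ k * [ suc n C suc k ] * (ε * f (suc k))))
        ≈⟨ +-congˡ (∑<-+ (suc n) g (λ k → ε ^ k * [ suc n C suc k ] * (ε * f (suc k)))) ⟨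
      f 0 + ∑< (suc n) (λ k → g k + ε ^ k * [ suc n C suc k ] * (ε * f (suc k)))
        ≈⟨ +-congˡ (∑<-cong (suc n) λ k _ → sym (distribˡ _ (f k) (ε * f (suc k)))) ⟩
      f 0 + B n (λ k → f k + ε * f (suc k)) ∎
      where
      g : ℕ → Carrier
      g k = ε ^ k * [ suc n C suc k ] * f k

    B-cong : ∀ n {f g} → (∀ k → f k ≈ g k) → B n f ≈ B n g
    B-cong n h = ∑<-cong (suc n) λ k _ → *-congˡ (h k)

  -- Writing B n f for the left-hand side with [ k C m ] replaced by f k, Pascal's rule gives
  -- B (n+1) f = f 0 + B n (f - f ∘ suc), and f ↦ f - f ∘ suc sends [ _ C m+1 ] to -[ _ C m ].
  alternating-C-sum : ∀ n m → m ≤ n → ∑< (suc n) (λ k → ε ^ k * [ suc n C suc k ] * [ k C m ]) ≈ ε ^ m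
  alternating-C-sum zero    zero    _ = trans (∑<-suc 0 _) (trans (+-congʳ (∑<-zero 0 λ _ ()))
    (solve 0 (con 0 :+ con 1 :* (con 1 :+ con 0) :* (con 1 :+ con 0) := con 1) refl))
  alternating-C-sum (suc n) zero    _ = begin
    B (suc n) (λ _ → [ 1 ])                 ≈⟨ B-suc n (λ _ → [ 1 ]) ⟩
    -- For m = 0 the function is constantly 1, so all its differences vanish.
    [ 1 ] + B n (λ _ → [ 1 ] + ε * [ 1 ])   ≈⟨ +-cong (+-identityʳ 1#) (∑<-zero (suc n) λ k _ → trans (*-congˡ (ε-inverse [ 1 ])) (zeroʳ _)) ⟩
    1# + 0#                                 ≈⟨ +-identityʳ 1# ⟩
    1#                                      ∎
  alternating-C-sum (suc n) (suc m) (s≤s m≤n) = begin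
    B (suc n) (λ k → [ k C suc m ])                                         ≈⟨ B-suc n _ ⟩
    [ 0 C suc m ] + B n (λ k → [ k C suc m ] + ε * [ suc k C suc m ])       ≈⟨ +-cong (C-vanish {0} {suc m} (s≤s z≤n)) (B-cong n step) ⟩
    0# + B n (λ k → ε * [ k C m ])                                          ≈⟨ +-identityˡ _ ⟩
    B n (λ k → ε * [ k C m ])                                               ≈⟨ ∑<-cong (suc n) (λ k _ → solve 3 (λ s e u → s :* (e :* u) := e :* (s :* u)) refl _ ε [ k C m ]) ⟩
    ∑< (suc n) (λ k → ε * (ε ^ k * [ suc n C suc k ] * [ k C m ]))          ≈⟨ ∑<-* (suc n) ε _ ⟩
    ε * B n (λ k → [ k C m ])                                               ≈⟨ *-congˡ (alternating-C-sum n m m≤n) ⟩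
    ε ^ suc m                                                               ∎
    where
    step : ∀ k → [ k C suc m ] + ε * [ suc k C suc m ] ≈ ε * [ k C m ]
    step k = begin
      [ k C suc m ] + ε * [ suc k C suc m ]                ≈⟨ +-congˡ (*-congˡ (pascal k m)) ⟩
      [ k C suc m ] + ε * ([ k C m ] + [ k C suc m ])      ≈⟨ solve 3 (λ e u v → v :+ e :* (u :+ v) := (v :+ e :* v) :+ e :* u) refl ε _ _ ⟩
      ([ k C suc m ] + ε * [ k C suc m ]) + ε * [ k C m ]  ≈⟨ +-congʳ (ε-inverse _) ⟩
      0# + ε * [ k C m ]                                   ≈⟨ +-identityˡ _ ⟩
      ε * [ k C m ]                                        ∎

  -- Recursions for elementary symmetric polynomials.

  e-∷ : ∀ k y ys → e (suc k) (y ∷ ys) ≈ y * e k ys + e (suc k) ys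
  e-∷ k y ys = sum-++ (choose k ys) (choose (suc k) ys)
    where
    sum-++ : ∀ us vs → sum (map product (map (y ∷_) us ++ vs)) ≈ y * sum (map product us) + sum (map product vs)
    sum-++ []       vs = sym (trans (+-congʳ (zeroʳ y)) (+-identityˡ _))
    sum-++ (u ∷ us) vs = trans (+-congˡ (sum-++ us vs))
      (solve 4 (λ y u s t → y :* u :+ (y :* s :+ t) := y :* (u :+ s) :+ t) refl y (product u) _ _)

  -- `choose` recurses from the front of a list, whereas x_1, ..., x_j grows at the back. Induction
  -- on the list splits off the head on both sides.
  e-∷ʳ : ∀ k ys y → e (suc k) (ys ∷ʳ y) ≈ e (suc k) ys + y * e k ys
  e-∷ʳ zero    []       y = solve 1 (λ y → (y :* con 1) :+ con 0 := con 0 :+ y :* (con 1 :+ con 0)) refl y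
  e-∷ʳ (suc k) []       y = sym (trans (+-identityˡ _) (zeroʳ y))
  e-∷ʳ zero    (z ∷ zs) y = begin
    e 1 (z ∷ zs ∷ʳ y)                ≈⟨ e-∷ 0 z (zs ∷ʳ y) ⟩
    z * e 0 zs + e 1 (zs ∷ʳ y)       ≈⟨ +-congˡ (e-∷ʳ 0 zs y) ⟩
    z * e 0 zs + (e 1 zs + y * e 0 zs) ≈⟨ +-assoc _ _ _ ⟨
    z * e 0 zs + e 1 zs + y * e 0 zs ≈⟨ +-congʳ (e-∷ 0 z zs) ⟨
    e 1 (z ∷ zs) + y * e 0 zs        ∎
  e-∷ʳ (suc k) (z ∷ zs) y = begin
    e (2 ℕ.+ k) (z ∷ zs ∷ʳ y)
      ≈⟨ e-∷ (suc k) z (zs ∷ʳ y) ⟩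
    z * e (suc k) (zs ∷ʳ y) + e (2 ℕ.+ k) (zs ∷ʳ y)
      ≈⟨ +-cong (*-congˡ (e-∷ʳ k zs y)) (e-∷ʳ (suc k) zs y) ⟩
    z * (e (suc k) zs + y * e k zs) + (e (2 ℕ.+ k) zs + y * e (suc k) zs)
      ≈⟨ solve 5 (λ z y p q r → z :* (p :+ y :* q) :+ (r :+ y :* p) := (z :* p :+ r) :+ y :* (z :* q :+ p)) refl z y _ _ _ ⟩
    (z * e (suc k) zs + e (2 ℕ.+ k) zs) + y * (z * e k zs + e (suc k) zs)
      ≈⟨ +-cong (e-∷ (suc k) z zs) (*-congˡ (e-∷ k z zs)) ⟨
    e (2 ℕ.+ k) (z ∷ zs) + y * e (suc k) (z ∷ zs) ∎

  sum-∷ʳ : ∀ ys y → sum (ys ∷ʳ y) ≈ sum ys + y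
  sum-∷ʳ []       y = +-comm y 0#
  sum-∷ʳ (z ∷ zs) y = trans (+-congˡ (sum-∷ʳ zs y)) (sym (+-assoc z _ y))

  -- Partial sums and consecutive products of the variables.

  module Runs (x : ℕ → Carrier) where

    s : ℕ → Carrier
    s j = ∑ 1 j x

    E : ℕ → ℕ → Carrier
    E k j = e k (map x [ 1 ⋯ j ])

    -- The product x_i ⋯ x_{i+l-1}, indexed by its length so that splitting off either end needs no
    -- subtraction.
    run : ℕ → ℕ → Carrier
    run i zero    = 1#
    run i (suc l) = x i * run (suc i) l

    d : ℕ → Carrier
    d i = x i + ε * x (suc i)

    private
      vars-suc : ∀ j → map x [ 1 ⋯ suc j ] ≡ map x [ 1 ⋯ j ] ∷ʳ x (suc j)
      vars-suc j = ≡.trans (≡.cong (map x) (≡.sym (List.applyUpTo-∷ʳ suc j))) (List.map-++ x (applyUpTo suc j) _)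

    s-suc : ∀ j → s (suc j) ≈ s j + x (suc j)
    s-suc j = trans (reflexive (≡.cong sum (vars-suc j))) (sum-∷ʳ (map x [ 1 ⋯ j ]) _)

    E-suc : ∀ k j → E (suc k) (suc j) ≈ E (suc k) j + x (suc j) * E k j
    E-suc k j = trans (reflexive (≡.cong (e (suc k)) (vars-suc j))) (e-∷ʳ k (map x [ 1 ⋯ j ]) _)

    run-∷ʳ : ∀ i l → run i (suc l) ≈ run i l * x (i ℕ.+ l)
    run-∷ʳ i zero    = trans (*-comm _ _) (*-congˡ (reflexive (≡.cong x (≡.sym (ℕ.+-identityʳ i)))))
    run-∷ʳ i (suc l) = trans (*-congˡ (run-∷ʳ (suc i) l))
      (trans (sym (*-assoc _ _ _)) (*-congˡ (reflexive (≡.cong x (≡.sym (ℕ.+-suc i l))))))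

    ∏≈run : ∀ lo l → ∏ lo (lo ℕ.+ l) x ≈ run lo (suc l)
    ∏≈run lo l = trans
      (reflexive (≡.cong (λ h → product (map x (applyUpTo (lo ℕ.+_) h)))
        (≡.trans (ℕ.+-∸-assoc 1 (ℕ.m≤m+n lo l)) (≡.cong suc (ℕ.m+n∸m≡n lo l)))))
      (go lo (suc l) (lo ℕ.+_) λ _ → ≡.refl)
      where
      -- `applyUpTo` composes its function with `suc` at each step, so the induction runs over every
      -- `f` that agrees with addition to `i`.
      go : ∀ i h (f : ℕ → ℕ) → (∀ t → f t ≡ i ℕ.+ t) → product (map x (applyUpTo f h)) ≈ run i h
      go i zero    f eq = refl
      go i (suc h) f eq = *-cong (reflexive (≡.cong x (≡.trans (eq 0) (ℕ.+-identityʳ i))))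
        (go (suc i) h (f ∘ suc) λ t → ≡.trans (eq (suc t)) (ℕ.+-suc i t))

    -- Consequences of the quadratic relations, with positive integers invertible.

    module Relations
      (p : ℕ)
      (s*x≈s*x⁺ : ∀ j → 1 ≤ j → j ≤ p → s j * x j ≈ s j * x (suc j))
      (unit : ∀ k → ∃ λ u → u * [ suc k ] ≈ 1#)
      where

      s*d≈0 : ∀ j → 1 ≤ j → j ≤ p → s j * d j ≈ 0#
      s*d≈0 j 1≤j j≤p = begin
        s j * (x j + ε * x (suc j))               ≈⟨ solve 4 (λ s y e z → s :* (y :+ e :* z) := s :* y :+ e :* (s :* z)) refl (s j) (x j) ε (x (suc j)) ⟩
        s j * x j + ε * (s j * x (suc j))         ≈⟨ +-congʳ (s*x≈s*x⁺ j 1≤j j≤p) ⟩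
        s j * x (suc j) + ε * (s j * x (suc j))   ≈⟨ ε-inverse _ ⟩
        0#                                        ∎

      []-cancel : ∀ k {y z} → [ suc k ] * y ≈ [ suc k ] * z → y ≈ z
      []-cancel k {y} {z} h with u , u*k≈1 ← unit k = begin
        y                   ≈⟨ *-identityˡ y ⟨
        1# * y              ≈⟨ *-congʳ u*k≈1 ⟨
        u * [ suc k ] * y   ≈⟨ *-assoc _ _ _ ⟩
        u * ([ suc k ] * y) ≈⟨ *-congˡ h ⟩
        u * ([ suc k ] * z) ≈⟨ *-assoc _ _ _ ⟨
        u * [ suc k ] * z   ≈⟨ *-congʳ u*k≈1 ⟩
        1# * z              ≈⟨ *-identityˡ z ⟩
        z                   ∎

      -- Induction on r = b - j. The relation at j turns s_j x_{j+1} into x_j s_j, so x_j factors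
      -- out; one of the copies of x_{j+1} then turns s_j into s_{j+1}, and what remains is the case
      -- of j+1.
      s*run*d : ∀ r j b → 1 ≤ j → j ℕ.+ r ≡ b → b ≤ p →
                s j * run (suc j) r * d b + [ r ] * (run j (suc r) * d b) ≈ 0#
      s*run*d zero j b 1≤j eq b≤p rewrite ≡.trans (≡.sym eq) (ℕ.+-identityʳ j) =
        trans (solve 3 (λ s d t → s :* con 1 :* d :+ con 0 :* t := s :* d) refl (s j) (d j) (run j 1 * d j)) (s*d≈0 j 1≤j b≤p)
      s*run*d (suc r) j b 1≤j eq b≤p = begin
        s j * (x (suc j) * q) * d b + (1# + [ r ]) * (x j * (x (suc j) * q) * d b)
          ≈⟨ solve 6 (λ s y z q d n → s :* (z :* q) :* d :+ (con 1 :+ n) :* (y :* (z :* q) :* d)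
               := (s :* z) :* (q :* d) :+ (con 1 :+ n) :* (y :* (z :* q) :* d)) refl (s j) (x j) (x (suc j)) q (d b) [ r ] ⟩
        (s j * x (suc j)) * (q * d b) + (1# + [ r ]) * (x j * (x (suc j) * q) * d b)
          ≈⟨ +-congʳ (*-congʳ (s*x≈s*x⁺ j 1≤j j≤p)) ⟨
        (s j * x j) * (q * d b) + (1# + [ r ]) * (x j * (x (suc j) * q) * d b)
          ≈⟨ solve 6 (λ s y z q d n → (s :* y) :* (q :* d) :+ (con 1 :+ n) :* (y :* (z :* q) :* d)
               := y :* ((s :+ z) :* q :* d :+ n :* (z :* q :* d))) refl (s j) (x j) (x (suc j)) q (d b) [ r ] ⟩
        x j * ((s j + x (suc j)) * q * d b + [ r ] * (x (suc j) * q * d b))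
          ≈⟨ *-congˡ (+-congʳ (*-congʳ (*-congʳ (s-suc j)))) ⟨
        x j * (s (suc j) * q * d b + [ r ] * (x (suc j) * q * d b))
          ≈⟨ *-congˡ (s*run*d r (suc j) b (s≤s z≤n) (≡.trans (≡.sym (ℕ.+-suc j r)) eq) b≤p) ⟩
        x j * 0#
          ≈⟨ zeroʳ _ ⟩
        0# ∎
        where
        q = run (2 ℕ.+ j) r
        j≤p = ℕ.≤-trans (ℕ.m≤m+n j (suc r)) (ℕ.≤-trans (ℕ.≤-reflexive eq) b≤p)

      -- Over ℤ this does not determine E (suc k) (suc j); dividing by suc k is the only use of ℚ.
      [k+1]*E : ∀ k j → j ≤ p → [ suc k ] * E (suc k) (suc j) ≈ s (suc j) * E k j
      [k+1]*E zero zero _ = solve 1 (λ y → (con 1 :+ con 0) :* (y :* con 1 :+ con 0) := (y :+ con 0) :* (con 1 :+ con 0)) refl (x 1)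
      [k+1]*E (suc k) zero _ = trans (zeroʳ _) (sym (zeroʳ _))
      [k+1]*E k (suc j) j<p = begin
        [ suc k ] * E (suc k) (2 ℕ.+ j)
          ≈⟨ *-congˡ (E-suc k (suc j)) ⟩
        [ suc k ] * (E (suc k) (suc j) + x (2 ℕ.+ j) * E k (suc j))
          ≈⟨ distribˡ _ _ _ ⟩
        [ suc k ] * E (suc k) (suc j) + [ suc k ] * (x (2 ℕ.+ j) * E k (suc j))
          ≈⟨ +-congʳ ([k+1]*E k j (ℕ.<⇒≤ j<p)) ⟩
        s (suc j) * E k j + (1# + [ k ]) * (x (2 ℕ.+ j) * E k (suc j))
          ≈⟨ solve 5 (λ s e n y e′ → s :* e :+ (con 1 :+ n) :* (y :* e′) := (s :* e :+ n :* (y :* e′)) :+ y :* e′) refl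
               (s (suc j)) (E k j) [ k ] (x (2 ℕ.+ j)) (E k (suc j)) ⟩
        (s (suc j) * E k j + [ k ] * (x (2 ℕ.+ j) * E k (suc j))) + x (2 ℕ.+ j) * E k (suc j)
          ≈⟨ +-congʳ (lower k) ⟩
        s (suc j) * E k (suc j) + x (2 ℕ.+ j) * E k (suc j)
          ≈⟨ distribʳ _ _ _ ⟨
        (s (suc j) + x (2 ℕ.+ j)) * E k (suc j)
          ≈⟨ *-congʳ (s-suc (suc j)) ⟨
        s (2 ℕ.+ j) * E k (suc j) ∎
        where
        -- The outer induction hypothesis trades the numeral for a factor s_{j+1}. Next to that
        -- factor x_{j+2} may be replaced by x_{j+1}, which completes the recursion for
        -- e_k(x_1,...,x_{j+1}).
        lower : ∀ k → s (suc j) * E k j + [ k ] * (x (2 ℕ.+ j) * E k (suc j)) ≈ s (suc j) * E k (suc j)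
        lower zero    = trans (+-congˡ (zeroˡ _)) (+-identityʳ _)
        lower (suc k) = begin
          s (suc j) * E (suc k) j + [ suc k ] * (x (2 ℕ.+ j) * E (suc k) (suc j))
            ≈⟨ +-congˡ (solve 3 (λ n y e → n :* (y :* e) := y :* (n :* e)) refl [ suc k ] (x (2 ℕ.+ j)) _) ⟩
          s (suc j) * E (suc k) j + x (2 ℕ.+ j) * ([ suc k ] * E (suc k) (suc j))
            ≈⟨ +-congˡ (*-congˡ ([k+1]*E k j (ℕ.<⇒≤ j<p))) ⟩
          s (suc j) * E (suc k) j + x (2 ℕ.+ j) * (s (suc j) * E k j)
            ≈⟨ +-congˡ (solve 3 (λ y s e → y :* (s :* e) := (s :* y) :* e) refl (x (2 ℕ.+ j)) (s (suc j)) (E k j)) ⟩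
          s (suc j) * E (suc k) j + (s (suc j) * x (2 ℕ.+ j)) * E k j
            ≈⟨ +-congˡ (*-congʳ (s*x≈s*x⁺ (suc j) (s≤s z≤n) j<p)) ⟨
          s (suc j) * E (suc k) j + (s (suc j) * x (suc j)) * E k j
            ≈⟨ trans (+-congˡ (*-assoc _ _ _)) (sym (distribˡ _ _ _)) ⟩
          s (suc j) * (E (suc k) j + x (suc j) * E k j)
            ≈⟨ *-congˡ (E-suc k j) ⟨
          s (suc j) * E (suc k) (suc j) ∎

      module _ (a n : ℕ) (b≤p : suc a ℕ.+ n ≤ p) where

        private
          -- The lower index of the product is `suc a` here, so `n` is the upper index minus the
          -- lower one, and `T` is the whole product times d_b.
          b = suc a ℕ.+ n
          T = run (suc a) (suc n) * d b

        -- Induction on k, after multiplying by k+1. Then e_{k+1} becomes s e_k, the factor s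
        -- extends the run downwards by one variable at the cost of -r, and r C(n,k) = (k+1)
        -- C(n,k+1) lets k+1 be cancelled.
        E*run*d : ∀ k r → k ℕ.+ r ≡ suc n →
                  E k (a ℕ.+ k) * run (suc (a ℕ.+ k)) r * d b ≈ ε ^ k * [ n C k ] * T
        E*run*d zero r ≡.refl rewrite ℕ.+-identityʳ a =
          trans (*-assoc _ _ _) (*-congʳ (solve 0 (con 1 :+ con 0 := con 1 :* (con 1 :+ con 0)) refl))
        E*run*d (suc k) r eq rewrite ℕ.+-suc a k = []-cancel k (begin
          [ suc k ] * (E (suc k) (suc j) * q * d b)
            ≈⟨ solve 4 (λ n e q d → n :* (e :* q :* d) := (n :* e) :* (q :* d)) refl [ suc k ] (E (suc k) (suc j)) q (d b) ⟩
          ([ suc k ] * E (suc k) (suc j)) * (q * d b)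
            ≈⟨ *-congʳ ([k+1]*E k j (ℕ.<⇒≤ j<p)) ⟩
          (s (suc j) * E k j) * (q * d b)
            ≈⟨ solve 4 (λ s e q d → (s :* e) :* (q :* d) := e :* (s :* q :* d)) refl (s (suc j)) (E k j) q (d b) ⟩
          E k j * (s (suc j) * q * d b)
            ≈⟨ *-congˡ (trans (+-transpose (s*run*d r (suc j) b (s≤s z≤n) b-eq b≤p)) (+-identityˡ _)) ⟩
          E k j * (ε * ([ r ] * (run (suc j) (suc r) * d b)))
            ≈⟨ solve 5 (λ e ε r w d → e :* (ε :* (r :* (w :* d))) := (ε :* r) :* (e :* w :* d)) refl (E k j) ε [ r ] (run (suc j) (suc r)) (d b) ⟩
          (ε * [ r ]) * (E k j * run (suc j) (suc r) * d b)
            ≈⟨ *-congˡ (E*run*d k (suc r) (≡.trans (ℕ.+-suc k r) eq)) ⟩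
          (ε * [ r ]) * (ε ^ k * [ n C k ] * T)
            ≈⟨ solve 5 (λ ε r g c t → (ε :* r) :* (g :* c :* t) := ε :* g :* (r :* c) :* t) refl ε [ r ] (ε ^ k) [ n C k ] T ⟩
          ε ^ suc k * ([ r ] * [ n C k ]) * T
            ≈⟨ *-congʳ (*-congˡ absorb) ⟩
          ε ^ suc k * ([ suc k ] * [ n C suc k ]) * T
            ≈⟨ solve 4 (λ g m c t → g :* (m :* c) :* t := m :* (g :* c :* t)) refl (ε ^ suc k) [ suc k ] [ n C suc k ] T ⟩
          [ suc k ] * (ε ^ suc k * [ n C suc k ] * T) ∎)
          where
          j = a ℕ.+ k
          q = run (2 ℕ.+ j) r
          k+r≡n : k ℕ.+ r ≡ n
          k+r≡n = ℕ.suc-injective eq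
          b-eq : suc j ℕ.+ r ≡ b
          b-eq = ≡.cong suc (≡.trans (ℕ.+-assoc a k r) (≡.cong (a ℕ.+_) k+r≡n))
          j<p : j < p
          j<p = ℕ.≤-trans (ℕ.m≤m+n (suc j) r) (ℕ.≤-trans (ℕ.≤-reflexive b-eq) b≤p)
          absorb : [ r ] * [ n C k ] ≈ [ suc k ] * [ n C suc k ]
          absorb = begin
            [ r ] * [ n C k ]           ≈⟨ ×1-homo-* r (n C k) ⟨
            [ r ℕ.* (n C k) ]           ≈⟨ ×-congˡ (≡.subst (λ t → r ℕ.* (t C k) ≡ suc k ℕ.* (t C suc k)) k+r≡n (≡.sym ([k+1]*nC[k+1]≡[n∸k]*nCk k r))) ⟩
            [ suc k ℕ.* (n C suc k) ]   ≈⟨ ×1-homo-* (suc k) (n C suc k) ⟩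
            [ suc k ] * [ n C suc k ]   ∎

        -- Dropping the last variable from e_{k+1} subtracts that variable times e_k. The variable
        -- joins the run, so `E*run*d` evaluates both terms, and Pascal's rule adds them.
        E⁺*run*d : ∀ k r → k ℕ.+ r ≡ n →
                   E (suc k) (a ℕ.+ k) * run (2 ℕ.+ (a ℕ.+ k)) r * d b ≈ ε * (ε ^ k * [ suc n C suc k ] * T)
        E⁺*run*d k r eq = begin
          E (suc k) j * q * d b
            ≈⟨ +-transpose (begin
                 E (suc k) j * q * d b + E k j * (x (suc j) * q) * d b
                   ≈⟨ solve 5 (λ u v y q d → u :* q :* d :+ v :* (y :* q) :* d := (u :+ y :* v) :* q :* d) refl (E (suc k) j) (E k j) (x (suc j)) q (d b) ⟩
                 (E (suc k) j + x (suc j) * E k j) * q * d b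
                   ≈⟨ *-congʳ (*-congʳ (E-suc k j)) ⟨
                 E (suc k) (suc j) * q * d b
                   ≡⟨ ≡.cong (λ i → E (suc k) i * run (suc i) r * d b) (ℕ.+-suc a k) ⟨
                 E (suc k) (a ℕ.+ suc k) * run (suc (a ℕ.+ suc k)) r * d b
                   ≈⟨ E*run*d (suc k) r (≡.cong suc eq) ⟩
                 ε ^ suc k * [ n C suc k ] * T ∎) ⟩
          ε ^ suc k * [ n C suc k ] * T + ε * (E k j * run (suc j) (suc r) * d b)
            ≈⟨ +-congˡ (*-congˡ (E*run*d k (suc r) (≡.trans (ℕ.+-suc k r) (≡.cong suc eq)))) ⟩
          ε ^ suc k * [ n C suc k ] * T + ε * (ε ^ k * [ n C k ] * T)
            ≈⟨ solve 5 (λ ε g u v t → ε :* g :* u :* t :+ ε :* (g :* v :* t) := ε :* (g :* (v :+ u) :* t)) refl ε (ε ^ k) [ n C suc k ] [ n C k ] T ⟩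
          ε * (ε ^ k * ([ n C k ] + [ n C suc k ]) * T)
            ≈⟨ *-congˡ (*-congʳ (*-congˡ (pascal n k))) ⟨
          ε * (ε ^ k * [ suc n C suc k ] * T) ∎
          where
          j = a ℕ.+ k
          q = run (2 ℕ.+ j) r

        -- Up to the common sign, this sum is what the right-hand side gains, beyond the factor x_b,
        -- when the upper index passes from b-1 to b.
        ∑E⁺*run*d : ∀ m → m ≤ n →
          ∑< (suc n) (λ k → [ k C m ] * (E (suc k) (a ℕ.+ k) * run (2 ℕ.+ (a ℕ.+ k)) (n ∸ k) * d b)) ≈ ε * ε ^ m * T
        ∑E⁺*run*d m m≤n = begin
          ∑< (suc n) (λ k → [ k C m ] * (E (suc k) (a ℕ.+ k) * run (2 ℕ.+ (a ℕ.+ k)) (n ∸ k) * d b))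
            ≈⟨ ∑<-cong (suc n) (λ k k≤n → trans (*-congˡ (E⁺*run*d k (n ∸ k) (ℕ.m+[n∸m]≡n (s≤s⁻¹ k≤n))))
                 (solve 4 (λ c e g t → c :* (e :* (g :* t)) := e :* t :* (g :* c)) refl [ k C m ] ε _ T)) ⟩
          ∑< (suc n) (λ k → ε * T * (ε ^ k * [ suc n C suc k ] * [ k C m ]))
            ≈⟨ ∑<-* (suc n) (ε * T) _ ⟩
          ε * T * ∑< (suc n) (λ k → ε ^ k * [ suc n C suc k ] * [ k C m ])
            ≈⟨ *-congˡ (alternating-C-sum n m m≤n) ⟩
          ε * T * ε ^ m
            ≈⟨ solve 3 (λ e t g → e :* t :* g := e :* g :* t) refl ε T (ε ^ m) ⟩
          ε * ε ^ m * T ∎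

      -- The induction on the upper end of the product.

      module _ (a m : ℕ) where

        private
          -- The summand at i = `suc a` + k, where m stands for c - `suc a`. The number h counts the
          -- factors of the product on the left, so its upper index is a + h.
          term : ℕ → ℕ → Carrier
          term h k = [ k C m ] * (E (suc k) (a ℕ.+ k) * (run (suc (a ℕ.+ k)) (h ∸ k) + ε * run (2 ℕ.+ (a ℕ.+ k)) (h ∸ k)))

          term-vanish : ∀ h k → k < m → term h k ≈ 0#
          term-vanish h k k<m = trans (*-congʳ (C-vanish k<m)) (zeroˡ _)

          -- Both runs are empty at k = h, leaving 1 - 1. Hence a sum over k < h may be extended to
          -- k = h, which makes the ranges match in the induction step.
          term-diagonal : ∀ h → term h h ≈ 0#
          term-diagonal h rewrite ℕ.n∸n≡0 h = trans (*-congˡ (trans (*-congˡ (ε-inverse 1#)) (zeroʳ _))) (zeroʳ _)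

          -- Each run gains a last factor, y or y⁺, and u y - v y⁺ = y (u - v) + v (y - y⁺).
          term-suc : ∀ h k → k ≤ h → term (suc h) k
                   ≈ x (suc a ℕ.+ h) * term h k + [ k C m ] * (E (suc k) (a ℕ.+ k) * run (2 ℕ.+ (a ℕ.+ k)) (h ∸ k) * d (suc a ℕ.+ h))
          term-suc h k k≤h rewrite ℕ.+-∸-assoc 1 k≤h = begin
            w * (f * (run i (suc r) + ε * run (suc i) (suc r)))
              ≈⟨ *-congˡ (*-congˡ (+-cong (trans (run-∷ʳ i r) (*-congˡ (reflexive (≡.cong x i+r≡)))) (*-congˡ (trans (run-∷ʳ (suc i) r) (*-congˡ (reflexive (≡.cong (x ∘ suc) i+r≡))))))) ⟩
            w * (f * (u * y + ε * (v * y⁺)))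
              ≈⟨ +-identityʳ _ ⟨
            w * (f * (u * y + ε * (v * y⁺))) + 0#
              ≈⟨ +-congˡ (ε-inverse (w * f * v * y)) ⟨
            w * (f * (u * y + ε * (v * y⁺))) + (w * f * v * y + ε * (w * f * v * y))
              ≈⟨ solve 7 (λ w f u v y y⁺ ε → w :* (f :* (u :* y :+ ε :* (v :* y⁺))) :+ (w :* f :* v :* y :+ ε :* (w :* f :* v :* y))
                   := y :* (w :* (f :* (u :+ ε :* v))) :+ w :* (f :* v :* (y :+ ε :* y⁺))) refl w f u v y y⁺ ε ⟩
            y * (w * (f * (u + ε * v))) + w * (f * v * (y + ε * y⁺)) ∎
            where
            r = h ∸ k
            i = suc (a ℕ.+ k)
            w = [ k C m ]
            f = E (suc k) (a ℕ.+ k)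
            u = run i r
            v = run (suc i) r
            y = x (suc a ℕ.+ h)
            y⁺ = x (2 ℕ.+ (a ℕ.+ h))
            i+r≡ : i ℕ.+ r ≡ suc a ℕ.+ h
            i+r≡ = ≡.cong suc (≡.trans (ℕ.+-assoc a k r) (≡.cong (a ℕ.+_) (ℕ.m+[n∸m]≡n k≤h)))

          -- The upper index is b = a + (m + l), so l is b - c + 1 and the induction on l starts at
          -- b = c - 1.
          difference : ∀ l → a ℕ.+ (m ℕ.+ l) ≤ p →
            (x (suc a ℕ.+ m) + ε * x (suc a ℕ.+ (m ℕ.+ l))) * run (suc a) (m ℕ.+ l)
              ≈ ε * ε ^ m * ∑< (m ℕ.+ l) (term (m ℕ.+ l))
          -- At b = c - 1 the left side contains x_c - x_c, and every k in the sum is below m, so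
          -- C(k,m) = 0.
          difference zero _ rewrite ℕ.+-identityʳ m = trans
            (trans (*-congʳ (ε-inverse _)) (zeroˡ _))
            (sym (trans (*-congˡ (∑<-zero m (term-vanish m))) (zeroʳ _)))
          difference (suc l) b≤p rewrite ℕ.+-suc m l = begin
            (z + ε * x (suc a ℕ.+ suc h)) * run (suc a) (suc h)
              ≈⟨ *-congˡ (run-∷ʳ (suc a) h) ⟩
            (z + ε * x (suc a ℕ.+ suc h)) * (u * y)
              ≡⟨ ≡.cong (λ i → (z + ε * x (suc i)) * (u * y)) (ℕ.+-suc a h) ⟩
            (z + ε * y⁺) * (u * y)
              ≈⟨ +-identityʳ _ ⟨
            (z + ε * y⁺) * (u * y) + 0#
              -- Inserting u y y - u y y separates x_{b+1} times the previous case from the new term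
              -- P(a,b+1) d_{b+1}.
              ≈⟨ +-congˡ (ε-inverse (u * y * y)) ⟨
            (z + ε * y⁺) * (u * y) + (u * y * y + ε * (u * y * y))
              ≈⟨ solve 5 (λ z ε y⁺ u y → (z :+ ε :* y⁺) :* (u :* y) :+ (u :* y :* y :+ ε :* (u :* y :* y))
                   := y :* ((z :+ ε :* y) :* u) :+ (u :* y) :* (y :+ ε :* y⁺)) refl z ε y⁺ u y ⟩
            y * ((z + ε * y) * u) + (u * y) * (y + ε * y⁺)
              ≈⟨ +-cong (*-congˡ (difference l (ℕ.<⇒≤ b≤p′))) (*-congʳ (sym (run-∷ʳ (suc a) h))) ⟩
            y * (ε * ε ^ m * ∑< h (term h)) + run (suc a) (suc h) * (y + ε * y⁺)
              ≈⟨ +-cong (solve 3 (λ y g t → y :* (g :* t) := g :* (y :* t)) refl y (ε * ε ^ m) _) T≈ ⟩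
            g * (y * ∑< h (term h)) + g * ∑< (suc h) rest
              ≈⟨ +-congʳ (*-congˡ (*-congˡ (trans (sym (+-identityʳ _)) (+-congˡ (sym (term-diagonal h)))))) ⟩
            g * (y * (∑< h (term h) + term h h)) + g * ∑< (suc h) rest
              ≈⟨ +-congʳ (*-congˡ (*-congˡ (∑<-suc h (term h)))) ⟨
            g * (y * ∑< (suc h) (term h)) + g * ∑< (suc h) rest
              ≈⟨ trans (sym (distribˡ _ _ _)) (*-congˡ (+-congʳ (sym (∑<-* (suc h) y (term h))))) ⟩
            g * (∑< (suc h) (λ k → y * term h k) + ∑< (suc h) rest)
              ≈⟨ *-congˡ (∑<-+ (suc h) (λ k → y * term h k) rest) ⟨
            g * ∑< (suc h) (λ k → y * term h k + rest k)
              ≈⟨ *-congˡ (∑<-cong (suc h) λ k k≤h → term-suc h k (s≤s⁻¹ k≤h)) ⟨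
            g * ∑< (suc h) (term (suc h)) ∎
            where
            h = m ℕ.+ l
            b≤p′ : suc a ℕ.+ h ≤ p
            b≤p′ = ℕ.≤-trans (ℕ.≤-reflexive (≡.sym (ℕ.+-suc a h))) b≤p
            g = ε * ε ^ m
            z = x (suc a ℕ.+ m)
            u = run (suc a) h
            y = x (suc a ℕ.+ h)
            y⁺ = x (2 ℕ.+ (a ℕ.+ h))
            rest : ℕ → Carrier
            rest k = [ k C m ] * (E (suc k) (a ℕ.+ k) * run (2 ℕ.+ (a ℕ.+ k)) (h ∸ k) * d (suc a ℕ.+ h))
            T≈ : run (suc a) (suc h) * (y + ε * y⁺) ≈ g * ∑< (suc h) rest
            T≈ = sym (begin
              g * ∑< (suc h) rest     ≈⟨ *-congˡ (∑E⁺*run*d a h b≤p′ m (ℕ.m≤m+n m l)) ⟩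
              -- The sum contributes the sign `g` a second time, and the square of a sign is 1.
              g * (g * T)             ≈⟨ solve 3 (λ ε g t → (ε :* g) :* ((ε :* g) :* t) := ((ε :* ε) :* (g :* g)) :* t) refl ε (ε ^ m) T ⟩
              ((ε * ε) * (ε ^ m * ε ^ m)) * T ≈⟨ *-congʳ (trans (*-cong ε*ε≈1 (sign² m)) (*-identityˡ 1#)) ⟩
              1# * T                  ≈⟨ *-identityˡ T ⟩
              T                       ∎)
              where T = run (suc a) (suc h) * (y + ε * y⁺)

        -- Return to the sums and products of the statement.

        private
          -- The summands of the two sums of the theorem, for the indices a = `suc a`, c = `suc a` +
          -- m and b = c + l.
          first second : ℕ → ℕ → Carrier
          first  l i = ((i ∸ suc a) C m) × (E (suc (i ∸ suc a)) (i ∸ 1) * ∏ i (suc a ℕ.+ (m ℕ.+ l)) x)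
          second l i = ((i ∸ suc a) C m) × (E (suc (i ∸ suc a)) (i ∸ 1) * ∏ (suc i) (suc (suc a ℕ.+ (m ℕ.+ l))) x)

          -- The product has m + `suc l` = b - a + 1 factors, and both runs at i = c + k have l - k
          -- + 1 of them.
          term-shift : ∀ l k → k ≤ l → term (m ℕ.+ suc l) (m ℕ.+ k)
                     ≈ first l (suc a ℕ.+ m ℕ.+ k) + ε * second l (suc a ℕ.+ m ℕ.+ k)
          term-shift l k k≤l
            rewrite ℕ.+-assoc a m k | ℕ.m+n∸m≡n a (m ℕ.+ k) | ℕ.[m+n]∸[m+o]≡n∸o m (suc l) k | ℕ.+-∸-assoc 1 k≤l = begin
            w * (f * (run i (suc r) + ε * run (suc i) (suc r)))
              ≈⟨ solve 5 (λ w f u ε v → w :* (f :* (u :+ ε :* v)) := w :* (f :* u) :+ ε :* (w :* (f :* v))) refl w f _ ε _ ⟩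
            w * (f * run i (suc r)) + ε * (w * (f * run (suc i) (suc r)))
              ≈⟨ +-cong (weigh (∏≈run i r)) (*-congˡ (weigh (∏≈run (suc i) r))) ⟨
            ν × (f * ∏ i (i ℕ.+ r) x) + ε * (ν × (f * ∏ (suc i) (suc i ℕ.+ r) x))
              ≡⟨ ≡.cong (λ t → ν × (f * ∏ i t x) + ε * (ν × (f * ∏ (suc i) (suc t) x))) i+r≡ ⟩
            ν × (f * ∏ i (suc a ℕ.+ (m ℕ.+ l)) x) + ε * (ν × (f * ∏ (suc i) (suc (suc a ℕ.+ (m ℕ.+ l))) x)) ∎
            where
            i = suc (a ℕ.+ (m ℕ.+ k))
            r = l ∸ k
            ν = (m ℕ.+ k) C m
            w = [ ν ]
            f = E (suc (m ℕ.+ k)) (a ℕ.+ (m ℕ.+ k))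
            weigh : ∀ {u v} → u ≈ v → ν × (f * u) ≈ w * (f * v)
            weigh h = trans (×≈[]* ν _) (*-congˡ (*-congˡ h))
            i+r≡ : i ℕ.+ r ≡ suc a ℕ.+ (m ℕ.+ l)
            i+r≡ = ≡.cong suc (≡.trans (ℕ.+-assoc a (m ℕ.+ k) r) (≡.cong (a ℕ.+_)
              (≡.trans (ℕ.+-assoc m k r) (≡.cong (m ℕ.+_) (ℕ.m+[n∸m]≡n k≤l)))))

        -- Write x_c P(a,b) as (x_c - x_{b+1}) P(a,b) + P(a,b+1). The first part is `difference` at
        -- `suc l`, since its induction starts at b = c - 1.
        multiplication : ∀ l → suc a ℕ.+ (m ℕ.+ l) ≤ p →
          x (suc a ℕ.+ m) * ∏ (suc a) (suc a ℕ.+ (m ℕ.+ l)) x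
            ≈ ε * ε ^ m * ∑ (suc a ℕ.+ m) (suc a ℕ.+ (m ℕ.+ l)) (first l)
            + ε ^ m * ∑ (suc a ℕ.+ m) (suc a ℕ.+ (m ℕ.+ l)) (second l)
            + ∏ (suc a) (suc (suc a ℕ.+ (m ℕ.+ l))) x
        multiplication l b≤p = begin
          z * ∏ (suc a) b x
            ≈⟨ *-congˡ (∏≈run (suc a) (m ℕ.+ l)) ⟩
          z * run (suc a) (suc (m ℕ.+ l))
            ≡⟨ ≡.cong (λ t → z * run (suc a) t) (ℕ.+-suc m l) ⟨
          z * u
            ≈⟨ solve 2 (λ z u → z :* u := z :* u :+ con 0) refl z u ⟩
          z * u + 0#
            ≈⟨ +-congˡ (ε-inverse (u * y)) ⟨
          z * u + (u * y + ε * (u * y))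
            ≈⟨ solve 4 (λ z u ε y → z :* u :+ (u :* y :+ ε :* (u :* y)) := (z :+ ε :* y) :* u :+ u :* y) refl z u ε y ⟩
          (z + ε * y) * u + u * y
            ≈⟨ +-cong (difference (suc l) (ℕ.≤-trans (ℕ.≤-reflexive (≡.trans (≡.cong (a ℕ.+_) (ℕ.+-suc m l)) (ℕ.+-suc a _))) b≤p)) (sym (run-∷ʳ (suc a) h)) ⟩
          ε * ε ^ m * ∑< h (term h) + run (suc a) (suc h)
            ≈⟨ +-cong (*-congˡ sums) tail ⟩
          ε * ε ^ m * (S₁ + ε * S₂) + ∏ (suc a) (suc b) x
            -- The minus sign in P(i,b) - P(i+1,b+1) cancels the extra `ε`, leaving the second sum
            -- with sign (-1)^(c-a).
            ≈⟨ +-congʳ (solve 4 (λ ε g u v → ε :* g :* (u :+ ε :* v) := ε :* g :* u :+ ε :* ε :* (g :* v)) refl ε (ε ^ m) S₁ S₂) ⟩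
          ε * ε ^ m * S₁ + ε * ε * (ε ^ m * S₂) + ∏ (suc a) (suc b) x
            ≈⟨ +-congʳ (+-congˡ (trans (*-congʳ ε*ε≈1) (*-identityˡ _))) ⟩
          ε * ε ^ m * S₁ + ε ^ m * S₂ + ∏ (suc a) (suc b) x ∎
          where
          h = m ℕ.+ suc l
          b = suc a ℕ.+ (m ℕ.+ l)
          z = x (suc a ℕ.+ m)
          u = run (suc a) h
          y = x (suc a ℕ.+ h)
          S₁ = ∑ (suc a ℕ.+ m) b (first l)
          S₂ = ∑ (suc a ℕ.+ m) b (second l)
          ∑≈ : ∀ f → ∑ (suc a ℕ.+ m) b f ≈ ∑< (suc l) (λ k → f (suc a ℕ.+ m ℕ.+ k))
          ∑≈ f = trans (reflexive (≡.cong (λ t → ∑ (suc a ℕ.+ m) t f) (≡.sym (≡.cong suc (ℕ.+-assoc a m l))))) (∑≈∑< (suc a ℕ.+ m) l f)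
          sums : ∑< h (term h) ≈ S₁ + ε * S₂
          sums = begin
            ∑< h (term h)
              ≈⟨ ∑<-++ m (suc l) (term h) ⟩
            ∑< m (term h) + ∑< (suc l) (λ k → term h (m ℕ.+ k))
              -- The weights C(k,m) with k < m vanish, which is why the sums start at i = c.
              ≈⟨ trans (+-congʳ (∑<-zero m (term-vanish h))) (+-identityˡ _) ⟩
            ∑< (suc l) (λ k → term h (m ℕ.+ k))
              ≈⟨ ∑<-cong (suc l) (λ k k≤l → term-shift l k (s≤s⁻¹ k≤l)) ⟩
            ∑< (suc l) (λ k → first l (suc a ℕ.+ m ℕ.+ k) + ε * second l (suc a ℕ.+ m ℕ.+ k))
              ≈⟨ ∑<-+ (suc l) _ _ ⟩
            ∑< (suc l) (λ k → first l (suc a ℕ.+ m ℕ.+ k)) + ∑< (suc l) (λ k → ε * second l (suc a ℕ.+ m ℕ.+ k))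
              ≈⟨ +-cong (sym (∑≈ (first l))) (trans (∑<-* (suc l) ε _) (*-congˡ (sym (∑≈ (second l))))) ⟩
            S₁ + ε * S₂ ∎
          tail : run (suc a) (suc h) ≈ ∏ (suc a) (suc b) x
          tail = begin
            run (suc a) (suc h)              ≈⟨ ∏≈run (suc a) h ⟨
            ∏ (suc a) (suc (a ℕ.+ h)) x      ≡⟨ ≡.cong (λ t → ∏ (suc a) (suc t) x) (≡.trans (≡.cong (a ℕ.+_) (ℕ.+-suc m l)) (ℕ.+-suc a _)) ⟩
            ∏ (suc a) (suc b) x              ∎

      multiplication-formula : ∀ a b c → 1 ≤ a → a ≤ c → c ≤ b → b ≤ p →
        x c * (∏[ a ≤ j ≤ b ] x j)
          ≈ ([-1]^ (+ c -ℤ + a -ℤ + 1)) * (∑[ c ≤ i ≤ b ] (((i ∸ a) C (c ∸ a)) × (e (suc (i ∸ a)) (map x [ 1 ⋯ i ∸ 1 ]) * (∏[ i ≤ j ≤ b ] x j))))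
          + ([-1]^ (+ c -ℤ + a)) * (∑[ c ≤ i ≤ b ] (((i ∸ a) C (c ∸ a)) × (e (suc (i ∸ a)) (map x [ 1 ⋯ i ∸ 1 ]) * (∏[ suc i ≤ j ≤ suc b ] x j))))
          + (∏[ a ≤ j ≤ suc b ] x j)
      multiplication-formula (suc a) b c (s≤s z≤n) a≤c c≤b b≤p
        -- Substituting c = a + m and b = c + l turns the difference c - a, in the exponents and in
        -- the binomials, into m.
        with m , ≡.refl ← ℕ.m≤n⇒∃[o]m+o≡n a≤c
        with l , ≡.refl ← ℕ.m≤n⇒∃[o]m+o≡n c≤b
        rewrite [+a+m]-[+a]≡+m (suc a) m | ℕ.m+n∸m≡n a m | ℕ.+-assoc a m l =
          trans (multiplication a m l b≤p) (+-congʳ (+-congʳ (*-congʳ ([-1]^[m-1] m))))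

-- Invertibility of positive integers in ℚ[x_1,...,x_n].

module InverseNumerals (n : ℕ) where

  open MvPolynomial n
  open CommutativeRing commutativeRing using (_+_; _*_; 1#; semiring; setoid; +-congˡ; *-identityʳ)
  open import Algebra.Properties.Semiring.Mult semiring using (_×_; ×-comm-*; ×-congʳ)
  open import Algebra.Properties.Semiring.Mult (CommutativeRing.semiring ℚ.+-*-commutativeRing) using () renaming (_×_ to _×ℚ_; ×-assoc-* to ×ℚ-assoc-*)

  private
    nonNegative-×ℚ : ∀ k → ℚ.NonNegative (k ×ℚ 1ℚ)
    nonNegative-×ℚ zero    = _
    nonNegative-×ℚ (suc k) = ℚ.nonNeg+nonNeg⇒nonNeg 1ℚ (k ×ℚ 1ℚ) {{nonNegative-×ℚ k}}

    reciprocal : ∀ p → ℚ.Positive p → ∃ λ q → p ℚ.* q ≡ 1ℚ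
    reciprocal p pos = ℚ.1/_ p {{p≢0}} , ℚ.*-inverseʳ p {{p≢0}}
      where
      p≢0 : ℚ.NonZero p
      p≢0 = ℚ.pos⇒nonZero p {{pos}}

    -- Opaque, because Agda would otherwise run the normalisation of fractions on open terms.
    opaque
      ×ℚ-inverse : ∀ k → ∃ λ q → suc k ×ℚ q ≡ 1ℚ
      ×ℚ-inverse k with q , p*q≡1 ← reciprocal (suc k ×ℚ 1ℚ) (ℚ.pos+nonNeg⇒pos 1ℚ (k ×ℚ 1ℚ) {{nonNegative-×ℚ k}}) =
        q , ≡.trans (≡.cong (suc k ×ℚ_) (≡.sym (ℚ.*-identityˡ q))) (≡.trans (≡.sym (×ℚ-assoc-* (suc k) 1ℚ q)) p*q≡1)

  open import Relation.Binary.Reasoning.Setoid setoid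

  private
    constant : ℚ → Poly
    constant q = (q , 0ᵉ) ∷ []

    -- One formal sum is empty and the other has a single zero term; they agree only coefficient by
    -- coefficient.
    constant-0 : 0ₚ ≈ constant 0ℚ
    constant-0 = mk≈ go
      where
      go : ∀ m → coeff m 0ₚ ≡ coeff m (constant 0ℚ)
      go m with does (Vec.≡-dec ℕ._≟_ 0ᵉ m)
      ... | true  = ≡.refl
      ... | false = ≡.refl

    constant-+ : ∀ q r → constant q + constant r ≈ constant (q ℚ.+ r)
    constant-+ q r = mk≈ go
      where
      go : ∀ m → coeff m (constant q + constant r) ≡ coeff m (constant (q ℚ.+ r))
      go m with does (Vec.≡-dec ℕ._≟_ 0ᵉ m)
      ... | true  = ≡.sym (ℚ.+-assoc q r 0ℚ)
      ... | false = ≡.refl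

    constant-× : ∀ k q → k × constant q ≈ constant (k ×ℚ q)
    constant-× zero    q = constant-0
    constant-× (suc k) q = begin
      constant q + k × constant q     ≈⟨ +-congˡ {constant q} (constant-× k q) ⟩
      constant q + constant (k ×ℚ q)  ≈⟨ constant-+ q (k ×ℚ q) ⟩
      constant (suc k ×ℚ q)           ∎

    constant-inverse : ∀ k q → suc k ×ℚ q ≡ 1ℚ → constant q * (suc k × 1#) ≈ 1#
    constant-inverse k q k×q≡1 = begin
      constant q * (suc k × 1#)   ≈⟨ ×-comm-* (suc k) (constant q) 1# ⟩
      suc k × (constant q * 1#)   ≈⟨ ×-congʳ (suc k) (*-identityʳ (constant q)) ⟩
      suc k × constant q          ≈⟨ constant-× (suc k) q ⟩
      constant (suc k ×ℚ q)       ≡⟨ ≡.cong constant k×q≡1 ⟩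
      1#                          ∎

  unit : ∀ k → ∃ λ u → u * (suc k × 1#) ≈ 1#
  unit k = let q , k×q≡1 = ×ℚ-inverse k in constant q , constant-inverse k q k×q≡1

-- The relations in the presented cohomology ring.

module PetersonCohomology (n : ℕ) where

  open Peterson n hiding (_≈_; _+_; _*_)
  open CommutativeRing H* hiding (zero)
  open RingIdentities H* using ([_])
  open import Algebra.Properties.Ring (CommutativeRing.ring ℚ[x]) using (x[y-z]≈xy-xz)
  import Algebra.Properties.Semiring.Mult (CommutativeRing.semiring ℚ[x]) as ℚ[x]
  private module P = CommutativeRing ℚ[x]

  private
    lift : ∀ {f g} → f P.≈ g → f ≈ g
    lift {f} {g} h = mkMod (resp (P.sym (P.trans (P.+-congʳ {P.- g} h) (P.-‿inverseʳ g))) zero)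

    relation : ∀ k → 1 ≤ k → k ≤ n ∸ 1 → ∑ 1 k x * x k ≈ ∑ 1 k x * x (suc k)
    relation k 1≤k k≤n-1 = mkMod (resp (x[y-z]≈xy-xz (∑ 1 k x) (x k) (x (suc k))) (gen (quadratic k 1≤k k≤n-1)))

    -- The two sides agree definitionally only for literals: _×_ is parametrised by the equality of its monoid.
    numeral : ∀ k → k ℚ[x].× P.1# ≡ [ k ]
    numeral zero    = ≡.refl
    numeral (suc k) = ≡.cong (P.1# P.+_) (numeral k)

    unit : ∀ k → ∃ λ u → u * [ suc k ] ≈ 1#
    unit k with u , h ← InverseNumerals.unit n k = u , lift (≡.subst (λ y → u P.* y P.≈ P.1#) (numeral (suc k)) h)

  -- The bound p becomes n - 1, the number of quadratic generators.
  open RingIdentities.Runs.Relations H* x (n ∸ 1) relation unit public using (multiplication-formula)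

theorem3p5 : ∀ (n : ℕ) → 1 ≤ n → let open Peterson n in
    ∀ (a b c : ℕ) → 1 ≤ a → a ≤ c → c ≤ b → b ≤ n ∸ 1 →
    x c * (∏[ a ≤ j ≤ b ] x j)
    ≈ ([-1]^ (+ c -ℤ + a -ℤ + 1)) * (∑[ c ≤ i ≤ b ] (((i ∸ a) C (c ∸ a)) · (e (suc (i ∸ a)) (map x [ 1 ⋯ i ∸ 1 ]) * (∏[ i ≤ j ≤ b ] x j))))
    + ([-1]^ (+ c -ℤ + a)) * (∑[ c ≤ i ≤ b ] (((i ∸ a) C (c ∸ a)) · (e (suc (i ∸ a)) (map x [ 1 ⋯ i ∸ 1 ]) * (∏[ suc i ≤ j ≤ suc b ] x j))))
    + (∏[ a ≤ j ≤ suc b ] x j)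
theorem3p5 n _ a b c = PetersonCohomology.multiplication-formula n a b c
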